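{- Let $G$ be an arbitrary connected (finite or infinite, countable) undirected graph whose ports at every node are labeled by distinct positive integers (arbitrarily, with no coherence between nodes). Let $i\neq j$ be two distinct positive integers (the labels of two agents), and let $v\ne w$ be arbitrary nodes of $G$ (their starting nodes). Then Algorithm GraphRV guarantees asynchronous rendezvous: the route $R(v,i)$ of the agent with label $i$ starting at $v$ and the route $R(w,j)$ of the agent with label $j$ starting at $w$, as produced by Algorithm GraphRV, have the property that for every walk $f$ on $R(v,i)$ and every walk $g$ on $R(w,j)$ (chosen by the adversary) there is a time $t$ with $f(t)=g(t)$.
   Context: Graphs and ports. Each node $u$ of $G$ has its incident edges labeled by distinct positive integers (port numbers at $u$); an edge thus has one port number at each of its two endpoints. Node degrees may be finite or infinite. The graph is regarded as embedded in $\mathbb{R}^3$, nodes being points and edges being line segments joining them that are pairwise disjoint except for common endpoints (no crossings). Routes and walks. A route is an infinite (not necessarily simple) path in $G$, i.e. a sequence of segments (edges) $S_1,S_2,\dots$ with $S_m=[a_m,a_{m+1}]$, where $a_1$ is the starting node. A walk on this route is a function $f$ obtained as follows: choose an increasing sequence of reals $t_1=0<t_2<\cdots$ and continuous functions $f_m:[t_m,t_{m+1}]\to[a_m,a_{m+1}]$ (into the edge $S_m$) with $f_m(t_m)=a_m$, $f_m(t_{m+1})=a_{m+1}$, and put $f(t)=f_m(t)$ for $t\in[t_m,t_{m+1}]$. Two agents with walks $f,g$ meet at time $t$ if $f(t)=g(t)$ (as points of the embedded graph: a node or a point inside an edge). Algorithm GraphRV. Let $\mathcal{P}$ be the countable set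 of quadruples $(i,j,s',s'')$ where $i<j$ are positive integers and $s',s''$ are finite sequences of positive integers of the same length. Fix an enumeration (bijection from the positive integers) $(\varphi_1,\varphi_2,\dots)$ of $\mathcal{P}$, the same for all agents. For a finite path $r$, let $\overline{r}$ be the path with the same edges in the reverse order, and let juxtaposition denote concatenation. For a node $v$, label $l$ and integer $k\ge 0$, the closed path $R_k(v,l)$ from $v$ to $v$ (the part of the route built in the first $k$ phases) is defined recursively. $R_0(v,l)$ is the empty path. For $k\ge1$ let $\varphi_k=(i,j,s',s'')$. - If $l\notin\{i,j\}$, then $R_k(v,l)=R_{k-1}(v,l)$. - If $l=i$, set $s_1=s'$, $s_2=s''$, $l'=j$; if $l=j$, set $s_1=s''$, $s_2=s'$, $l'=i$. Write $s_1=(p_1,\dots,p_n)$. Starting at $v$, follow successively ports $p_1,p_2,\dots$, as long as the required number is a port at the current node; let $q$ be the path so traversed (with edges $e_1,e_2,\dots$) and let $a_m$ be the port number of $e_m$ at the endpoint at which it is entered. - If all $n$ ports could be followed and $s_2=(a_n,\dots,a_1)$, let $w$ be the end of $q$ and put $$R_k(v,l)=R_{k-1}(v,l)\;q\;R_{k-1}(w,l')\;\overline{q}\;\overline{R_{k-1}(v,l)}\;q\;\overline{R_{k-1}(w,l')}\;\overline{q}.$$ - Otherwise $R_k(v,l)=R_{k-1}(v,l)\,q\,\overline{q}$. Since $R_{k-1}(v,l)$ is always a prefix of $R_k(v,l)$, the route $R(v,l)$ of the agent with label $l$ starting at $v$ is defined as the sequence of edges having all $R_k(v,l)$ as prefixes.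 (An agent stops upon meeting the other one.) -}

module Defs where

open import Level using (0ℓ)
open import Algebra.Structures using (IsCommutativeRing)
open import Axiom.ExcludedMiddle using (ExcludedMiddle)
open import Data.Fin.Base using (Fin)
open import Data.List.Base using (List; []; _∷_; length; reverse)
open import Data.Maybe.Base using (Maybe; just; nothing)
open import Data.Nat.Base as ℕ using (ℕ; zero; suc; NonZero)
open import Data.Product.Base using (∃; ∃-syntax; Σ-syntax; _×_; _,_; proj₁; proj₂)
open import Data.Sum.Base using (_⊎_)
open import Data.Vec.Functional using (Vector)
open import Function.Base using (_∘_)
open import Function.Bundles using (_⤖_; module Bijection)
open import Relation.Binary.Core using (Rel)
open import Relation.Binary.Definitions using (Symmetric; Irreflexive)
open import Relation.Binary.Structures using (IsStrictTotalOrder)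
open import Relation.Binary.PropositionalEquality.Core using (_≡_)
open import Relation.Binary.Construct.Closure.ReflexiveTransitive as Star
  using (Star; ε; _◅_; _◅◅_)
open import Relation.Nullary.Decidable.Core using (yes; no)
open import Relation.Nullary.Negation.Core using (¬_)
import Relation.Binary.Construct.StrictToNonStrict as NonStrict

-- The instance field is irrelevant, so positive integers with the same value
-- are propositionally equal.
record ℕ⁺ : Set where
  constructor pos
  field
    value         : ℕ
    .{{nonZero}}  : NonZero value

-- The real numbers, given axiomatically as a Dedekind-complete ordered field.
-- Equality is a setoid equality so that, under excluded middle, the Dedekind
-- cuts ℚ → Bool up to pointwise equality form a model in Set.
record CompleteOrderedField : Set₁ where
  infix  4 _≈_ _<_ _≤_
  infixl 6 _+_ _-_
  infixl 7 _*_
  infix  8 -_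
  field
    Carrier : Set
    _≈_ _<_ : Rel Carrier 0ℓ
    _+_ _*_ : Carrier → Carrier → Carrier
    -_      : Carrier → Carrier
    0# 1#   : Carrier

    isCommutativeRing  : IsCommutativeRing _≈_ _+_ _*_ -_ 0# 1#
    isStrictTotalOrder : IsStrictTotalOrder _≈_ _<_
    0<1                : 0# < 1#
    +-monoˡ-<          : ∀ z {x y} → x < y → x + z < y + z
    *-positive         : ∀ {x y} → 0# < x → 0# < y → 0# < x * y
    inverse            : ∀ x → ¬ x ≈ 0# → ∃[ y ] x * y ≈ 1#

  _≤_ : Rel Carrier 0ℓ
  _≤_ = NonStrict._≤_ _≈_ _<_

  _-_ : Carrier → Carrier → Carrier
  x - y = x + - y

  UpperBound : (Carrier → Set) → Carrier → Set
  UpperBound P b = ∀ x → P x → x ≤ b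

  field
    supremum : ∀ (P : Carrier → Set) → ∃ P → ∃ (UpperBound P) →
               ∃[ s ] UpperBound P s × (∀ b → UpperBound P b → s ≤ b)

-- A simple undirected graph; `port u v` is the port number at u of the edge
-- {u , v}, and its value is irrelevant when u and v are not adjacent.
record PortGraph : Set₁ where
  field
    Node           : Set
    Adj            : Rel Node 0ℓ
    symmetric      : Symmetric Adj
    irreflexive    : Irreflexive _≡_ Adj
    port           : Node → Node → ℕ⁺
    port-injective : ∀ {u x y} → Adj u x → Adj u y → port u x ≡ port u y → x ≡ y

  -- Finite, not necessarily simple, paths.
  Path : Rel Node 0ℓ
  Path = Star Adj

  Connected : Set
  Connected = ∀ u v → Path u v

  infix 8 _⁻
  _⁻ : Symmetric Path
  _⁻ = Star.reverse symmetric

  -- For a path with edges e₁,…,eₙ, the port numbers a₁,…,aₙ, where aₘ is the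
  -- port of eₘ at the endpoint reached by traversing eₘ.
  entryPorts : ∀ {u v} → Path u v → List ℕ⁺
  entryPorts ε                     = []
  entryPorts (_◅_ {i = u} {j = x} _ p) = port x u ∷ entryPorts p

  -- A path is a prefix of the edge sequence [a₀,a₁],[a₁,a₂],…  As the graph is
  -- simple, comparing nodes is the same as comparing edges.
  Prefix : ∀ {u v} → Path u v → (ℕ → Node) → Set
  Prefix {u} ε       a = a 0 ≡ u
  Prefix {u} (_ ◅ p) a = a 0 ≡ u × Prefix p (a ∘ suc)

-- The proofs are irrelevant, so quadruples are equal when i, j, s′, s″ are.
record Quadruple : Set where
  field
    i j          : ℕ⁺
    s′ s″        : List ℕ⁺
    .i<j         : ℕ⁺.value i ℕ.< ℕ⁺.value j
    .sameLength  : length s′ ≡ length s″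

-- Excluded middle serves to decide whether a number is a port at a node, and
-- the equality tests of the algorithm.
module _ (em : ExcludedMiddle 0ℓ) where

  -- (s₁ , s₂ , l′) as seen by the agent labelled l; nothing if l ∉ {i , j}.
  role : Quadruple → ℕ⁺ → Maybe (List ℕ⁺ × List ℕ⁺ × ℕ⁺)
  role c l with em {P = l ≡ Quadruple.i c}
  ... | yes _ = just (Quadruple.s′ c , Quadruple.s″ c , Quadruple.j c)
  ... | no _ with em {P = l ≡ Quadruple.j c}
  ...   | yes _ = just (Quadruple.s″ c , Quadruple.s′ c , Quadruple.i c)
  ...   | no _  = nothing

  module _ (G : PortGraph) where
    open PortGraph G

    -- The path obtained by following the ports as long as possible.
    follow : (v : Node) → List ℕ⁺ → Σ[ w ∈ Node ] Path v w
    follow v []       = v , ε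
    follow v (p ∷ ps) with em {P = ∃[ u ] Adj v u × port v u ≡ p}
    ... | no _            = v , ε
    ... | yes (u , e , _) = proj₁ (follow u ps) , e ◅ proj₂ (follow u ps)

    -- The first conjunct says that all ports of s₁ could be followed.
    Successful : List ℕ⁺ → List ℕ⁺ → ∀ {v w} → Path v w → Set
    Successful s₁ s₂ q =
      length (entryPorts q) ≡ length s₁ × s₂ ≡ reverse (entryPorts q)

    -- One phase; `prev` is the family of paths R_{k-1}.
    phase : (prev : (v : Node) → ℕ⁺ → Path v v) →
            Quadruple → (v : Node) → ℕ⁺ → Path v v
    phase prev c v l with role c l
    ... | nothing = prev v l
    ... | just (s₁ , s₂ , l′) with follow v s₁
    ...   | w , q with em {P = Successful s₁ s₂ q}
    ...     | yes _ = prev v l ◅◅ q ◅◅ prev w l′ ◅◅ q ⁻ ◅◅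
                      prev v l ⁻ ◅◅ q ◅◅ prev w l′ ⁻ ◅◅ q ⁻
    ...     | no _  = prev v l ◅◅ q ◅◅ q ⁻

    module _ (φ : ℕ⁺ ⤖ Quadruple) where

      R : ℕ → (v : Node) → ℕ⁺ → Path v v
      R zero    v l = ε
      R (suc k) v l = phase (R k) (Bijection.to φ (pos (suc k))) v l

      -- `node` plays the role of a₁,a₂,… with indices shifted to start at 0.
      record Route (v : Node) (l : ℕ⁺) : Set where
        field
          node     : ℕ → Node
          adjacent : ∀ m → Adj (node m) (node (suc m))
          prefixes : ∀ k → Prefix (R k v l) node

module _ (ℝ : CompleteOrderedField) where
  open CompleteOrderedField ℝ

  -- Points of ℝ³.
  Point : Set
  Point = Vector Carrier 3

  infix 4 _≐_
  _≐_ : Rel Point 0ℓ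
  p ≐ q = ∀ c → p c ≈ q c

  OnSegment : Point → Point → Point → Set
  OnSegment a b p =
    ∃[ r ] 0# ≤ r × r ≤ 1# × (∀ c → p c ≈ (1# - r) * a c + r * b c)

  infix 4 _∈[_,_]
  _∈[_,_] : Carrier → Carrier → Carrier → Set
  x ∈[ s , t ] = s ≤ x × x ≤ t

  -- |x - y| < δ
  Within : Carrier → Carrier → Carrier → Set
  Within δ x y = - δ < x - y × x - y < δ

  -- Continuity on [s , t] for the maximum norm of ℝ³; values of f outside
  -- [s , t] play no role.
  ContinuousOn : Carrier → Carrier → (Carrier → Point) → Set
  ContinuousOn s t f =
    ∀ x → x ∈[ s , t ] → ∀ η → 0# < η →
    ∃[ δ ] 0# < δ ×
      (∀ y → y ∈[ s , t ] → Within δ y x → ∀ c → Within η (f y c) (f x c))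

  module _ (G : PortGraph) where
    open PortGraph G

    SameEdge : (u v x y : Node) → Set
    SameEdge u v x y = (u ≡ x × v ≡ y) ⊎ (u ≡ y × v ≡ x)

    record Embedding : Set where
      field
        point           : Node → Point
        point-injective : ∀ {u v} → point u ≐ point v → u ≡ v
        noCrossing      : ∀ {u v x y} → Adj u v → Adj x y → ¬ SameEdge u v x y →
                          ∀ p → OnSegment (point u) (point v) p →
                          OnSegment (point x) (point y) p →
                          ∃[ z ] (z ≡ u ⊎ z ≡ v) × (z ≡ x ⊎ z ≡ y) × p ≐ point z

    -- A walk on the edge sequence [a₀,a₁],[a₁,a₂],…; `piece m` is only
    -- meaningful on [time m , time (suc m)].  The increasing times may have
    -- a finite limit, in which case the walk is not defined for all t ≥ 0.
    record Walk (E : Embedding) (a : ℕ → Node) : Set where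
      open Embedding E
      field
        time       : ℕ → Carrier
        time-zero  : time 0 ≈ 0#
        increasing : ∀ m → time m < time (suc m)
        piece      : ℕ → Carrier → Point
        continuous : ∀ m → ContinuousOn (time m) (time (suc m)) (piece m)
        onEdge     : ∀ m t → t ∈[ time m , time (suc m) ] →
                     OnSegment (point (a m)) (point (a (suc m))) (piece m t)
        departs    : ∀ m → piece m (time m) ≐ point (a m)
        arrives    : ∀ m → piece m (time (suc m)) ≐ point (a (suc m))

    -- The walk is at the point p at time t, i.e. f(t) is defined and equals p.
    At : ∀ {E a} → Walk E a → Carrier → Point → Set
    At f t p = ∃[ m ] t ∈[ time m , time (suc m) ] × piece m t ≐ p
      where open Walk f

    Meet : ∀ {E a b} → Walk E a → Walk E b → Set
    Meet f g = ∃[ t ] ∃[ p ] At f t p × At g t p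

{-# OPTIONS --safe #-}
module Submission where

open import Level using (0ℓ)
open import Algebra.Bundles using (CommutativeRing)
import Algebra.Properties.Group as GroupProperties
import Algebra.Properties.Ring as RingProperties
open import Axiom.ExcludedMiddle using (ExcludedMiddle)
open import Data.Fin.Properties using (¬∀⟶∃¬)
open import Data.List.Base
  using (List; []; _∷_; _++_; _ʳ++_; applyDownFrom; applyUpTo; length; map; reverse)
open import Data.List.Properties
  using (++-conicalˡ; ++-conicalʳ; ++-monoid; length-map; length-reverse;
         map-++; map-∘; map-applyUpTo; map-id; reverse-++; reverse-involutive; reverse-map;
         reverse-applyUpTo; ∷-injectiveˡ; ∷-injectiveʳ)
open import Data.Maybe.Base using (just)
open import Data.Nat.Base as ℕ using (ℕ; zero; suc)
import Data.Nat.Properties as ℕ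
open import Data.Product.Base using (∃-syntax; Σ-syntax; _×_; _,_; proj₁; proj₂; swap)
open import Data.Sum.Base using (_⊎_; inj₁; inj₂)
import Data.Sum.Base as Sum
open import Function.Base using (_∘_)
open import Function.Bundles using (_⤖_; _↣_; module Bijection)
open import Relation.Binary.Bundles using (StrictPartialOrder)
open import Relation.Binary.Construct.Closure.ReflexiveTransitive
  using (ε; _◅_; _◅◅_; revApp)
import Relation.Binary.Construct.StrictToNonStrict as NonStrict
open import Relation.Binary.Definitions using (Tri; tri<; tri≈; tri>)
open import Relation.Binary.PropositionalEquality.Core as ≡ using (_≡_; _≢_)
import Relation.Binary.PropositionalEquality.Properties as ≡
import Relation.Binary.Reasoning.StrictPartialOrder as StrictPartialOrderReasoning
open import Relation.Binary.Structures using (IsStrictTotalOrder; IsTotalOrder)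
open import Relation.Nullary.Decidable.Core using (yes; no)
open import Relation.Nullary.Negation.Core using (¬_; contradiction)
open import Tactic.MonoidSolver using (solve)
open import Defs

-- For a path q from v to w, some phase treats (i, j) with the exit ports of q
-- and of q̄.  Writing A and B for the earlier parts of R(v,i) and R(w,j), this
-- phase extends them to Z̄ q̄ and Z q, where Z = B q̄ A q B̄ q̄ Ā: up to the final
-- q̄ and q, the agents traverse the same path Z in opposite directions.
-- Always advancing the agent that leaves its edge first, one finds a
-- common time interval that both spend on one edge of Z in opposite directions.
-- At its start one agent is at the endpoint where it enters the edge, at its
-- end one is where it leaves, so they meet by the intermediate value
-- theorem for a coordinate in which the endpoints of the edge differ.

-- Lists of directed edges and their reversal.

module _ {A : Set} where

  -- The effect of path reversal on a list of directed edges: each edge is turned around and the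
  -- order is reversed.
  retrace : List (A × A) → List (A × A)
  retrace = reverse ∘ map swap

  retrace-++ : ∀ xs ys → retrace (xs ++ ys) ≡ retrace ys ++ retrace xs
  retrace-++ xs ys =
    ≡.trans (≡.cong reverse (map-++ swap xs ys)) (reverse-++ (map swap xs) (map swap ys))

  retrace-involutive : ∀ xs → retrace (retrace xs) ≡ xs
  retrace-involutive xs = begin
    reverse (map swap (reverse (map swap xs))) ≡⟨ ≡.cong reverse (reverse-map swap (map swap xs)) ⟩
    reverse (reverse (map swap (map swap xs))) ≡⟨ reverse-involutive _ ⟩
    map swap (map swap xs)                     ≡⟨ map-∘ xs ⟨
    map (swap ∘ swap) xs                       ≡⟨ map-id xs ⟩
    xs                                         ∎
    where open ≡.≡-Reasoning

  -- The path Z of the overview, with A, q and B given by `xs`, `qs` and `ys`.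
  tunnel : (xs qs ys : List (A × A)) → List (A × A)
  tunnel xs qs ys =
    ys ++ retrace qs ++ xs ++ qs ++ retrace ys ++ retrace qs ++ retrace xs

  -- Retracing exchanges the two agents: up to cancelling double retracing of `qs`, the right side
  -- is `tunnel ys (retrace qs) xs`. This symmetry is what makes the two extended routes run against
  -- each other.
  retrace-tunnel : ∀ xs qs ys → retrace (tunnel xs qs ys) ≡
                   xs ++ qs ++ ys ++ retrace qs ++ retrace xs ++ qs ++ retrace ys
  retrace-tunnel xs qs ys
    rewrite retrace-++ ys (retrace qs ++ xs ++ qs ++ retrace ys ++ retrace qs ++ retrace xs)
          | retrace-++ (retrace qs) (xs ++ qs ++ retrace ys ++ retrace qs ++ retrace xs)
          | retrace-++ xs (qs ++ retrace ys ++ retrace qs ++ retrace xs)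
          | retrace-++ qs (retrace ys ++ retrace qs ++ retrace xs)
          | retrace-++ (retrace ys) (retrace qs ++ retrace xs)
          | retrace-++ (retrace qs) (retrace xs)
          | retrace-involutive xs | retrace-involutive qs | retrace-involutive ys
    = reassociate xs qs ys (retrace qs) (retrace xs) qs (retrace ys)
    where
    reassociate : ∀ (a b c d e f g : List (A × A)) →
                  (((((a ++ b) ++ c) ++ d) ++ e) ++ f) ++ g ≡ a ++ b ++ c ++ d ++ e ++ f ++ g
    reassociate a b c d e f g = solve (++-monoid (A × A))

  -- The shape of a successful phase, cut before its final walk along the connecting path, which
  -- lies outside the common path.
  split-last : ∀ (a b c d e f : List (A × A)) →
    a ++ b ++ c ++ d ++ e ++ b ++ f ++ d ≡ (a ++ b ++ c ++ d ++ e ++ b ++ f) ++ d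
  split-last a b c d e f = solve (++-monoid (A × A))

  applyUpTo-prefix : ∀ {n} (f : ℕ → A) xs {ys} →
                     xs ++ ys ≡ applyUpTo f n → xs ≡ applyUpTo f (length xs)
  applyUpTo-prefix f [] eq = ≡.refl
  applyUpTo-prefix {suc n} f (x ∷ xs) eq =
    ≡.cong₂ _∷_ (∷-injectiveˡ eq) (applyUpTo-prefix (f ∘ suc) xs (∷-injectiveʳ eq))

  -- `applyDownFrom g n` starts at index n - 1, so its entry at position `k` has index n - 1 - k.
  -- The equation on `m` and `k` says this without subtraction.
  applyUpTo≡applyDownFrom : ∀ {n} (f g : ℕ → A) → applyUpTo f n ≡ applyDownFrom g n →
                            ∀ m k → suc (m ℕ.+ k) ≡ n → f k ≡ g m
  applyUpTo≡applyDownFrom f g eq m zero ≡.refl =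
    ≡.trans (∷-injectiveˡ eq) (≡.cong g (ℕ.+-identityʳ m))
  applyUpTo≡applyDownFrom f g eq m (suc k) ≡.refl =
    applyUpTo≡applyDownFrom (f ∘ suc) g (∷-injectiveʳ eq) m k (≡.sym (ℕ.+-suc m k))

module _ {A : Set} where

  step : (ℕ → A) → ℕ → A × A
  step a m = a m , a (suc m)

  -- Reversing both sides of the hypothesis leaves swapped steps of `b` in increasing order against
  -- steps of `a` in decreasing order, which can be compared entry by entry.
  opposite-steps : (a b : ℕ → A) (n : ℕ) →
                   retrace (applyUpTo (step b) n) ≡ applyUpTo (step a) n →
                   ∀ m k → suc (m ℕ.+ k) ≡ n → (b (suc k) , b k) ≡ (a m , a (suc m))
  opposite-steps a b n eq = applyUpTo≡applyDownFrom (swap ∘ step b) (step a) (begin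
    applyUpTo (swap ∘ step b) n                    ≡⟨ map-applyUpTo (step b) swap n ⟨
    map swap (applyUpTo (step b) n)                ≡⟨ reverse-involutive _ ⟨
    reverse (retrace (applyUpTo (step b) n))       ≡⟨ ≡.cong reverse eq ⟩
    reverse (applyUpTo (step a) n)                 ≡⟨ reverse-applyUpTo (step a) n ⟩
    applyDownFrom (step a) n                       ∎)
    where open ≡.≡-Reasoning

-- Paths as edge lists, and their port numbers.

module _ (G : PortGraph) where
  open PortGraph G

  -- Paths are compared through these lists because one adjacency may have several proofs in `Adj`.
  edges : ∀ {u v} → Path u v → List (Node × Node)
  edges ε                               = []
  edges (_◅_ {i = u} {j = x} _ p) = (u , x) ∷ edges p

  edges≡[]⇒endpoints≡ : ∀ {u v} (p : Path u v) → edges p ≡ [] → u ≡ v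
  edges≡[]⇒endpoints≡ ε _ = ≡.refl

  edges-◅◅ : ∀ {u v w} (p : Path u v) (q : Path v w) → edges (p ◅◅ q) ≡ edges p ++ edges q
  edges-◅◅ ε       q = ≡.refl
  edges-◅◅ (e ◅ p) q = ≡.cong (_ ∷_) (edges-◅◅ p q)

  edges-revApp : ∀ {u v w} (p : Path u v) (q : Path u w) →
                 edges (revApp symmetric p q) ≡ map swap (edges p) ʳ++ edges q
  edges-revApp ε       q = ≡.refl
  edges-revApp (e ◅ p) q = edges-revApp p (symmetric e ◅ q)

  edges-⁻ : ∀ {u v} (p : Path u v) → edges (p ⁻) ≡ retrace (edges p)
  edges-⁻ p = edges-revApp p ε

  prefix-start : ∀ {u v} (p : Path u v) {a} → Prefix p a → u ≡ a 0
  prefix-start ε       eq       = ≡.sym eq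
  prefix-start (e ◅ p) (eq , _) = ≡.sym eq

  prefix-edges : ∀ {u v} (p : Path u v) {a} → Prefix p a →
                 edges p ≡ applyUpTo (step a) (length (edges p))
  prefix-edges ε _ = ≡.refl
  prefix-edges (e ◅ p) {a} (eq , pre) =
    ≡.cong₂ _∷_ (≡.cong₂ _,_ (≡.sym eq) (prefix-start p pre)) (prefix-edges p {a ∘ suc} pre)

  exitPort entryPort : Node × Node → ℕ⁺
  exitPort  (u , x) = port u x
  entryPort (u , x) = port x u

  exitPorts : ∀ {u v} → Path u v → List ℕ⁺
  exitPorts p = map exitPort (edges p)

  entryPorts≡map : ∀ {u v} (p : Path u v) → entryPorts p ≡ map entryPort (edges p)
  entryPorts≡map ε       = ≡.refl
  entryPorts≡map (e ◅ p) = ≡.cong (_ ∷_) (entryPorts≡map p)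

  -- The entry port of an edge is the exit port of the same edge turned around. Hence the list
  -- tested by `Successful` is the one that leads back along the path.
  exitPorts-⁻ : ∀ {u v} (p : Path u v) → exitPorts (p ⁻) ≡ reverse (entryPorts p)
  exitPorts-⁻ p = begin
    map exitPort (edges (p ⁻))                  ≡⟨ ≡.cong (map exitPort) (edges-⁻ p) ⟩
    map exitPort (reverse (map swap (edges p))) ≡⟨ reverse-map exitPort (map swap (edges p)) ⟩
    reverse (map exitPort (map swap (edges p))) ≡⟨ ≡.cong reverse (map-∘ (edges p)) ⟨
    reverse (map entryPort (edges p))           ≡⟨ ≡.cong reverse (entryPorts≡map p) ⟨
    reverse (entryPorts p)                      ∎
    where open ≡.≡-Reasoning

  length-exitPorts-⁻ : ∀ {u v} (p : Path u v) → length (exitPorts p) ≡ length (exitPorts (p ⁻))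
  length-exitPorts-⁻ p = begin
    length (exitPorts p)             ≡⟨ length-map exitPort (edges p) ⟩
    length (edges p)                 ≡⟨ length-map entryPort (edges p) ⟨
    length (map entryPort (edges p)) ≡⟨ ≡.cong length (entryPorts≡map p) ⟨
    length (entryPorts p)            ≡⟨ length-reverse (entryPorts p) ⟨
    length (reverse (entryPorts p))  ≡⟨ ≡.cong length (exitPorts-⁻ p) ⟨
    length (exitPorts (p ⁻))         ∎
    where open ≡.≡-Reasoning

  -- A successful phase of the algorithm.

  module _ (em : ExcludedMiddle 0ℓ) where

    -- By `port-injective` the neighbour found at each step is the next node of `p`. Its proof of
    -- adjacency may be a different one, so `q` is only shown to have the edges of `p`.
    follow-exitPorts : ∀ {v w} (p : Path v w) →
      Σ[ q ∈ Path v w ] follow em G v (exitPorts p) ≡ (w , q) × edges q ≡ edges p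
    follow-exitPorts ε = ε , ≡.refl , ≡.refl
    follow-exitPorts {v} (_◅_ {j = x} e p)
      with em {P = ∃[ u ] Adj v u × port v u ≡ port v x}
    ... | no ¬exists = contradiction (x , e , ≡.refl) ¬exists
    ... | yes (u , e′ , samePort) with port-injective e′ e samePort
    ...   | ≡.refl with follow-exitPorts p
    ...     | q , followed , sameEdges =
      e′ ◅ q , ≡.cong (λ z → proj₁ z , e′ ◅ proj₂ z) followed , ≡.cong (_ ∷_) sameEdges

    successful : ∀ {u v} (p : Path u v) {q : Path u v} → edges q ≡ edges p →
                 Successful em G (exitPorts p) (exitPorts (p ⁻)) q
    successful p {q} sameEdges = lengths , ports
      where
      open ≡.≡-Reasoning

      sameEntryPorts : entryPorts q ≡ entryPorts p
      sameEntryPorts = begin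
        entryPorts q            ≡⟨ entryPorts≡map q ⟩
        map entryPort (edges q) ≡⟨ ≡.cong (map entryPort) sameEdges ⟩
        map entryPort (edges p) ≡⟨ entryPorts≡map p ⟨
        entryPorts p            ∎

      lengths : length (entryPorts q) ≡ length (exitPorts p)
      lengths = begin
        length (entryPorts q)           ≡⟨ ≡.cong length sameEntryPorts ⟩
        length (entryPorts p)           ≡⟨ length-reverse (entryPorts p) ⟨
        length (reverse (entryPorts p)) ≡⟨ ≡.cong length (exitPorts-⁻ p) ⟨
        length (exitPorts (p ⁻))        ≡⟨ length-exitPorts-⁻ p ⟨
        length (exitPorts p)            ∎

      ports : exitPorts (p ⁻) ≡ reverse (entryPorts q)
      ports = ≡.trans (exitPorts-⁻ p) (≡.cong reverse (≡.sym sameEntryPorts))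

    phase-successful : ∀ prev c v l {s₁ s₂ l′ w q} →
      role em c l ≡ just (s₁ , s₂ , l′) → follow em G v s₁ ≡ (w , q) →
      Successful em G s₁ s₂ q →
      phase em G prev c v l ≡
        prev v l ◅◅ q ◅◅ prev w l′ ◅◅ q ⁻ ◅◅ prev v l ⁻ ◅◅ q ◅◅ prev w l′ ⁻ ◅◅ q ⁻
    phase-successful prev c v l {s₁} {s₂} {q = q} hasRole followed successful
      rewrite hasRole | followed with em {P = Successful em G s₁ s₂ q}
    ... | yes _    = ≡.refl
    ... | no fails = contradiction successful fails

    phase-edges : ∀ prev c l l′ {v w} (p : Path v w) →
      role em c l ≡ just (exitPorts p , exitPorts (p ⁻) , l′) →
      edges (phase em G prev c v l) ≡
        edges (prev v l) ++ edges p ++ edges (prev w l′) ++ retrace (edges p) ++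
        retrace (edges (prev v l)) ++ edges p ++ retrace (edges (prev w l′)) ++ retrace (edges p)
    phase-edges prev c l l′ {v} {w} p hasRole with follow-exitPorts p
    ... | q , followed , sameEdges
      rewrite phase-successful prev c v l hasRole followed (successful p sameEdges)
            | edges-◅◅ (prev v l) (q ◅◅ prev w l′ ◅◅ q ⁻ ◅◅ prev v l ⁻ ◅◅ q ◅◅ prev w l′ ⁻ ◅◅ q ⁻)
            | edges-◅◅ q (prev w l′ ◅◅ q ⁻ ◅◅ prev v l ⁻ ◅◅ q ◅◅ prev w l′ ⁻ ◅◅ q ⁻)
            | edges-◅◅ (prev w l′) (q ⁻ ◅◅ prev v l ⁻ ◅◅ q ◅◅ prev w l′ ⁻ ◅◅ q ⁻)
            | edges-◅◅ (q ⁻) (prev v l ⁻ ◅◅ q ◅◅ prev w l′ ⁻ ◅◅ q ⁻)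
            | edges-◅◅ (prev v l ⁻) (q ◅◅ prev w l′ ⁻ ◅◅ q ⁻)
            | edges-◅◅ q (prev w l′ ⁻ ◅◅ q ⁻)
            | edges-◅◅ (prev w l′ ⁻) (q ⁻)
            | edges-⁻ q | edges-⁻ (prev v l) | edges-⁻ (prev w l′) | sameEdges
      = ≡.refl

    role-i : ∀ c → role em c (Quadruple.i c) ≡ just (Quadruple.s′ c , Quadruple.s″ c , Quadruple.j c)
    role-i c with em {P = Quadruple.i c ≡ Quadruple.i c}
    ... | yes _  = ≡.refl
    ... | no i≢i = contradiction ≡.refl i≢i

    -- `role` tests the first label first, so the inequality is what leads past that branch.
    role-j : ∀ c → Quadruple.j c ≢ Quadruple.i c →
             role em c (Quadruple.j c) ≡ just (Quadruple.s″ c , Quadruple.s′ c , Quadruple.i c)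
    role-j c j≢i with em {P = Quadruple.j c ≡ Quadruple.i c}
    ... | yes j≡i = contradiction j≡i j≢i
    ... | no _ with em {P = Quadruple.j c ≡ Quadruple.j c}
    ...   | yes _  = ≡.refl
    ...   | no j≢j = contradiction ≡.refl j≢j

    -- A quadruple stores the smaller label first, so both labels and lists trade places when `j` is
    -- the smaller one.
    quadruple : ∀ {i j} → i ≢ j → ∀ s₁ s₂ → length s₁ ≡ length s₂ →
      ∃[ c ] role em c i ≡ just (s₁ , s₂ , j) × role em c j ≡ just (s₂ , s₁ , i)
    quadruple {i} {j} i≢j s₁ s₂ eq with ℕ.<-cmp (ℕ⁺.value i) (ℕ⁺.value j)
    ... | tri< i<j _ _ = c , role-i c , role-j c (i≢j ∘ ≡.sym)
      where c = record { i = i ; j = j ; s′ = s₁ ; s″ = s₂ ; i<j = i<j ; sameLength = eq }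
    -- Equal values give equal labels because the field `nonZero` is irrelevant.
    ... | tri≈ _ ≡.refl _ = contradiction ≡.refl i≢j
    ... | tri> _ _ j<i = c , role-j c i≢j , role-i c
      where c = record { i = j ; j = i ; s′ = s₂ ; s″ = s₁ ; i<j = j<i ; sameLength = ≡.sym eq }

    -- The common stretch of the two routes.

    module _ (φ : ℕ⁺ ⤖ Quadruple) where

      phase-number : ∀ c → ∃[ k ] Bijection.to φ (pos (suc k)) ≡ c
      phase-number c with Bijection.strictlySurjective φ c
      ... | pos (suc k) , eq = k , eq

      -- The witness makes `suc n` the number of edges of `Z`: edge `m` of one route is edge `k` of
      -- the other, turned around, whenever the two positions are mirror images in `Z`.
      opposite-routes : ∀ {i j} → i ≢ j → ∀ {v w} → Path v w → v ≢ w →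
        (ρ : Route em G φ v i) (σ : Route em G φ w j) →
        let a = Route.node ρ ; b = Route.node σ in
        ∃[ n ] (∀ m k → suc (m ℕ.+ k) ≡ suc n → (b (suc k) , b k) ≡ (a m , a (suc m)))
      opposite-routes {i} {j} i≢j {v} {w} p v≢w ρ σ
        with quadruple i≢j (exitPorts p) (exitPorts (p ⁻)) (length-exitPorts-⁻ p)
      ... | c , roleᵢ , roleⱼ with phase-number c
      ...   | k , eq = opposite
        where
        A B P Z : List (Node × Node)
        A = edges (R em G φ k v i)
        B = edges (R em G φ k w j)
        P = edges p
        Z = tunnel A P B

        -- Agent `j` takes `p ⁻` for its connecting path, so its phase refers to the ports of
        -- `p ⁻ ⁻`. This path has the edges of `p`, though possibly other proofs of adjacency.
        exitPorts-⁻⁻ : exitPorts (p ⁻ ⁻) ≡ exitPorts p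
        exitPorts-⁻⁻ = ≡.cong (map exitPort) (begin
          edges (p ⁻ ⁻)         ≡⟨ edges-⁻ (p ⁻) ⟩
          retrace (edges (p ⁻)) ≡⟨ ≡.cong retrace (edges-⁻ p) ⟩
          retrace (retrace P)   ≡⟨ retrace-involutive P ⟩
          P                     ∎)
          where open ≡.≡-Reasoning

        Rᵢ : edges (R em G φ (suc k) v i) ≡ retrace Z ++ retrace P
        Rᵢ = begin
          edges (phase em G (R em G φ k) (Bijection.to φ (pos (suc k))) v i)
            ≡⟨ ≡.cong (λ c → edges (phase em G (R em G φ k) c v i)) eq ⟩
          edges (phase em G (R em G φ k) c v i)
            ≡⟨ phase-edges (R em G φ k) c i j p roleᵢ ⟩
          A ++ P ++ B ++ retrace P ++ retrace A ++ P ++ retrace B ++ retrace P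
            ≡⟨ split-last A P B (retrace P) (retrace A) (retrace B) ⟩
          (A ++ P ++ B ++ retrace P ++ retrace A ++ P ++ retrace B) ++ retrace P
            ≡⟨ ≡.cong (_++ retrace P) (retrace-tunnel A P B) ⟨
          retrace Z ++ retrace P ∎
          where open ≡.≡-Reasoning

        Rⱼ : edges (R em G φ (suc k) w j) ≡ Z ++ P
        Rⱼ = begin
          edges (phase em G (R em G φ k) (Bijection.to φ (pos (suc k))) w j)
            ≡⟨ ≡.cong (λ c → edges (phase em G (R em G φ k) c w j)) eq ⟩
          edges (phase em G (R em G φ k) c w j)
            ≡⟨ phase-edges (R em G φ k) c j i (p ⁻)
                 (≡.trans roleⱼ (≡.cong (λ s → just (exitPorts (p ⁻) , s , i)) (≡.sym exitPorts-⁻⁻))) ⟩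
          B ++ edges (p ⁻) ++ A ++ retrace (edges (p ⁻)) ++
          retrace B ++ edges (p ⁻) ++ retrace A ++ retrace (edges (p ⁻))
            ≡⟨ ≡.cong (λ Q → B ++ Q ++ A ++ retrace Q ++ retrace B ++ Q ++ retrace A ++ retrace Q)
                 (edges-⁻ p) ⟩
          B ++ retrace P ++ A ++ retrace (retrace P) ++
          retrace B ++ retrace P ++ retrace A ++ retrace (retrace P)
            ≡⟨ ≡.cong (λ Q → B ++ retrace P ++ A ++ Q ++ retrace B ++ retrace P ++ retrace A ++ Q)
                 (retrace-involutive P) ⟩
          B ++ retrace P ++ A ++ P ++ retrace B ++ retrace P ++ retrace A ++ P
            ≡⟨ split-last B (retrace P) A P (retrace B) (retrace A) ⟩
          Z ++ P ∎
          where open ≡.≡-Reasoning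

        initial : ∀ {u l} (τ : Route em G φ u l) xs {ys} →
                  edges (R em G φ (suc k) u l) ≡ xs ++ ys →
                  xs ≡ applyUpTo (step (Route.node τ)) (length xs)
        initial {u} {l} τ xs split = applyUpTo-prefix _ xs
          (≡.trans (≡.sym split)
            (prefix-edges (R em G φ (suc k) u l) (Route.prefixes τ (suc k))))

        length-retrace : length (retrace Z) ≡ length Z
        length-retrace = ≡.trans (length-reverse (map swap Z)) (length-map swap Z)

        retraced : retrace (applyUpTo (step (Route.node σ)) (length Z)) ≡
                   applyUpTo (step (Route.node ρ)) (length Z)
        retraced = begin
          retrace (applyUpTo (step (Route.node σ)) (length Z)) ≡⟨ ≡.cong retrace (initial σ Z Rⱼ) ⟨
          retrace Z                                            ≡⟨ initial ρ (retrace Z) Rᵢ ⟩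
          applyUpTo (step (Route.node ρ)) (length (retrace Z)) ≡⟨ ≡.cong (applyUpTo _) length-retrace ⟩
          applyUpTo (step (Route.node ρ)) (length Z)           ∎
          where open ≡.≡-Reasoning

        Z≢[] : Z ≢ []
        -- `Z` contains `retrace P`, and an empty `P` would give `v ≡ w`.
        Z≢[] Z≡[] = v≢w (edges≡[]⇒endpoints≡ p (≡.trans (≡.sym (retrace-involutive P))
          (≡.cong retrace (++-conicalˡ (retrace P) _ (++-conicalʳ B _ Z≡[])))))

        opposite : ∃[ n ] (∀ m k → suc (m ℕ.+ k) ≡ suc n →
          (Route.node σ (suc k) , Route.node σ k) ≡ (Route.node ρ m , Route.node ρ (suc m)))
        -- Splitting `Z` exposes its length as a successor.
        opposite with Z | Z≢[] | retraced
        ... | []     | []≢[] | _  = contradiction ≡.refl []≢[]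
        ... | _ ∷ zs | _     | eq =
          length zs , opposite-steps (Route.node ρ) (Route.node σ) _ eq

-- Arithmetic and order in the real field.

module _ (ℝ : CompleteOrderedField) where
  open CompleteOrderedField ℝ

  private
    commutativeRing : CommutativeRing 0ℓ 0ℓ
    commutativeRing = record { isCommutativeRing = isCommutativeRing }

    strictPartialOrder : StrictPartialOrder 0ℓ 0ℓ 0ℓ
    strictPartialOrder = record
      { isStrictPartialOrder = IsStrictTotalOrder.isStrictPartialOrder isStrictTotalOrder }

  open CommutativeRing commutativeRing
    using ( refl; sym; trans; ring; +-group; +-cong; +-congˡ; +-congʳ; +-assoc; +-comm
          ; +-identityʳ; -‿inverseˡ; -‿inverseʳ; *-congˡ; *-congʳ; *-assoc; *-identityˡ
          ; distribˡ; distribʳ; zeroˡ)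
  open GroupProperties +-group
    using () renaming (∙-cancelˡ to +-cancelˡ; //-rightDividesˡ to x-y+y≈x; //-rightDividesʳ to x+y-y≈x)
  open RingProperties ring using ([y-z]x≈yx-zx)
  open IsStrictTotalOrder isStrictTotalOrder
    using (compare; irrefl; <-respʳ-≈; _≟_; _<?_) renaming (trans to <-trans)
  open IsTotalOrder (NonStrict.isTotalOrder _≈_ _<_ isStrictTotalOrder)
    using (total; antisym) renaming (refl to ≤-refl; trans to ≤-trans)
  open StrictPartialOrderReasoning strictPartialOrder

  x+[y-x]≈y : ∀ x y → x + (y - x) ≈ y
  x+[y-x]≈y x y = trans (+-comm x (y - x)) (x-y+y≈x x y)

  <⇒≱ : ∀ {x y} → x < y → ¬ y ≤ x
  <⇒≱ {x} {y} x<y y≤x = irrefl refl (begin-strict x <⟨ x<y ⟩ y ≤⟨ y≤x ⟩ x ∎)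

  ≮⇒≥ : ∀ {x y} → ¬ x < y → y ≤ x
  ≮⇒≥ {x} {y} x≮y with compare x y
  ... | tri< x<y _ _ = contradiction x<y x≮y
  ... | tri≈ _ x≈y _ = inj₂ (sym x≈y)
  ... | tri> _ _ y<x = inj₁ y<x

  +-monoʳ-< : ∀ z {x y} → x < y → z + x < z + y
  +-monoʳ-< z {x} {y} x<y = begin-strict
    z + x ≈⟨ +-comm z x ⟩
    x + z <⟨ +-monoˡ-< z x<y ⟩
    y + z ≈⟨ +-comm y z ⟩
    z + y ∎

  +-monoʳ-≤ : ∀ z {x y} → x ≤ y → z + x ≤ z + y
  +-monoʳ-≤ z (inj₁ x<y) = inj₁ (+-monoʳ-< z x<y)
  +-monoʳ-≤ z (inj₂ x≈y) = inj₂ (+-congˡ x≈y)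

  +-cancelʳ-< : ∀ z {x y} → x + z < y + z → x < y
  +-cancelʳ-< z {x} {y} lt = begin-strict
    x         ≈⟨ x+y-y≈x z x ⟨
    x + z - z <⟨ +-monoˡ-< (- z) lt ⟩
    y + z - z ≈⟨ x+y-y≈x z y ⟩
    y         ∎

  x-z<y⇒x<y+z : ∀ {x y z} → x - z < y → x < y + z
  x-z<y⇒x<y+z {x} {y} {z} lt = begin-strict
    x         ≈⟨ x-y+y≈x z x ⟨
    x - z + z <⟨ +-monoˡ-< z lt ⟩
    y + z     ∎

  x<y+z⇒x-z<y : ∀ {x y z} → x < y + z → x - z < y
  x<y+z⇒x-z<y {x} {y} {z} lt = begin-strict
    x - z     <⟨ +-monoˡ-< (- z) lt ⟩
    y + z - z ≈⟨ x+y-y≈x z y ⟩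
    y         ∎

  x<y⇒0<y-x : ∀ {x y} → x < y → 0# < y - x
  x<y⇒0<y-x {x} {y} x<y = begin-strict
    0#    ≈⟨ -‿inverseʳ x ⟨
    x - x <⟨ +-monoˡ-< (- x) x<y ⟩
    y - x ∎

  0<y⇒x<x+y : ∀ x {y} → 0# < y → x < x + y
  0<y⇒x<x+y x {y} 0<y = begin-strict
    x      ≈⟨ +-identityʳ x ⟨
    x + 0# <⟨ +-monoʳ-< x 0<y ⟩
    x + y  ∎

  half : ∀ d → 0# < d → ∃[ e ] 0# < e × e + e ≈ d
  half d 0<d = e , 0<e , e+e≈d
    where
    0<1+1 : 0# < 1# + 1#
    0<1+1 = <-trans 0<1 (0<y⇒x<x+y 1# 0<1)

    1/2 : ∃[ y ] (1# + 1#) * y ≈ 1#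
    1/2 = inverse (1# + 1#) (λ eq → irrefl (sym eq) 0<1+1)

    e : Carrier
    e = proj₁ 1/2 * d

    e+e≈d : e + e ≈ d
    e+e≈d = begin-equality
      e + e                       ≈⟨ +-cong (*-identityˡ e) (*-identityˡ e) ⟨
      1# * e + 1# * e             ≈⟨ distribʳ e 1# 1# ⟨
      (1# + 1#) * (proj₁ 1/2 * d) ≈⟨ *-assoc _ _ d ⟨
      (1# + 1#) * proj₁ 1/2 * d   ≈⟨ *-congʳ (proj₂ 1/2) ⟩
      1# * d                      ≈⟨ *-identityˡ d ⟩
      d                           ∎

    0<e : 0# < e
    0<e with 0# <? e
    ... | yes 0<e = 0<e
    ... | no  0≮e = contradiction e+e≤0 (<⇒≱ (<-respʳ-≈ (sym e+e≈d) 0<d))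
      where
      e+e≤0 : e + e ≤ 0#
      e+e≤0 = begin
        e + e  ≤⟨ +-monoʳ-≤ e (≮⇒≥ 0≮e) ⟩
        e + 0# ≈⟨ +-identityʳ e ⟩
        e      ≤⟨ ≮⇒≥ 0≮e ⟩
        0#     ∎

  *-monoˡ-< : ∀ {d} → 0# < d → ∀ {r s} → r < s → r * d < s * d
  *-monoˡ-< {d} 0<d {r} {s} r<s = begin-strict
    r * d                     <⟨ 0<y⇒x<x+y (r * d) (*-positive (x<y⇒0<y-x r<s) 0<d) ⟩
    r * d + (s - r) * d       ≈⟨ +-congˡ ([y-z]x≈yx-zx d s r) ⟩
    r * d + (s * d - r * d)   ≈⟨ x+[y-x]≈y (r * d) (s * d) ⟩
    s * d                     ∎

  *-monoˡ-≤ : ∀ {d} → 0# < d → ∀ {r s} → r ≤ s → r * d ≤ s * d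
  *-monoˡ-≤ 0<d (inj₁ r<s) = inj₁ (*-monoˡ-< 0<d r<s)
  *-monoˡ-≤ 0<d (inj₂ r≈s) = inj₂ (*-congʳ r≈s)

  *-cancelʳ-≈ : ∀ {d} → 0# < d → ∀ {r s} → r * d ≈ s * d → r ≈ s
  *-cancelʳ-≈ 0<d {r} {s} eq with compare r s
  ... | tri< r<s _ _ = contradiction (*-monoˡ-< 0<d r<s) (irrefl eq)
  ... | tri≈ _ r≈s _ = r≈s
  ... | tri> _ _ s<r = contradiction (*-monoˡ-< 0<d s<r) (irrefl (sym eq))

  -- A form of closeness without differences and symmetric in `x` and `y`, suited to chains of
  -- inequalities.
  within⇒< : ∀ {δ x y} → Within ℝ δ x y → x < y + δ × y < x + δ
  within⇒< {δ} {x} {y} (-δ<x-y , x-y<δ) =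
    <-respʳ-≈ (+-comm δ y) (x-z<y⇒x<y+z x-y<δ) ,
    x-z<y⇒x<y+z (begin-strict
      y - δ       ≈⟨ +-comm y (- δ) ⟩
      - δ + y     <⟨ +-monoˡ-< y -δ<x-y ⟩
      x - y + y   ≈⟨ x-y+y≈x y x ⟩
      x           ∎)

  <⇒within : ∀ {δ x y} → x < y + δ → y < x + δ → Within ℝ δ x y
  <⇒within {δ} {x} {y} x<y+δ y<x+δ = (begin-strict
      - δ         ≈⟨ x+y-y≈x y (- δ) ⟨
      - δ + y - y ≈⟨ +-congʳ (+-comm (- δ) y) ⟩
      y - δ - y   <⟨ +-monoˡ-< (- y) (x<y+z⇒x-z<y y<x+δ) ⟩
      x - y       ∎) ,
    x<y+z⇒x-z<y (<-respʳ-≈ (+-comm y δ) x<y+δ)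

  within-weaken : ∀ {δ ε x y} → δ ≤ ε → Within ℝ δ x y → Within ℝ ε x y
  within-weaken {x = x} {y} δ≤ε near with within⇒< near
  ... | x<y+δ , y<x+δ =
    <⇒within (begin-strict x <⟨ x<y+δ ⟩ y + _ ≤⟨ +-monoʳ-≤ y δ≤ε ⟩ y + _ ∎)
             (begin-strict y <⟨ y<x+δ ⟩ x + _ ≤⟨ +-monoʳ-≤ x δ≤ε ⟩ x + _ ∎)

  ∈-⊆ : ∀ {s t s′ t′ x} → s ≤ s′ → t′ ≤ t → _∈[_,_] ℝ x s′ t′ → _∈[_,_] ℝ x s t
  ∈-⊆ s≤s′ t′≤t (s′≤x , x≤t′) = ≤-trans s≤s′ s′≤x , ≤-trans x≤t′ t′≤t

  -- Continuity and the intermediate value theorem.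

  ContinuousFunction : Carrier → Carrier → (Carrier → Carrier) → Set
  ContinuousFunction s t h =
    ∀ x → _∈[_,_] ℝ x s t → ∀ η → 0# < η →
    ∃[ δ ] 0# < δ ×
      (∀ y → _∈[_,_] ℝ y s t → Within ℝ δ y x → Within ℝ η (h y) (h x))

  coordinate-continuous : ∀ {s t f} → ContinuousOn ℝ s t f →
                          ∀ c → ContinuousFunction s t (λ x → f x c)
  coordinate-continuous cont c x x∈ η 0<η with cont x x∈ η 0<η
  ... | δ , 0<δ , near = δ , 0<δ , λ y y∈ close → near y y∈ close c

  continuous-⊆ : ∀ {s t s′ t′ f} → s ≤ s′ → t′ ≤ t →
                 ContinuousOn ℝ s t f → ContinuousOn ℝ s′ t′ f
  continuous-⊆ s≤s′ t′≤t cont x x∈ η 0<η with cont x (∈-⊆ s≤s′ t′≤t x∈) η 0<η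
  ... | δ , 0<δ , near = δ , 0<δ , λ y y∈ → near y (∈-⊆ s≤s′ t′≤t y∈)

  module _ {s t h k} (h-cont : ContinuousFunction s t h) (k-cont : ContinuousFunction s t k) where

    -- Take η to be half the gap between `h x` and `k x`. Near `x` the function `h` rises and `k`
    -- falls by less than η, so the gap cannot close. The smaller of the two moduli serves for both.
    <-open : ∀ x → _∈[_,_] ℝ x s t → h x < k x →
             ∃[ δ ] 0# < δ × (∀ y → _∈[_,_] ℝ y s t → Within ℝ δ y x → h y < k y)
    <-open x x∈ hx<kx with half (k x - h x) (x<y⇒0<y-x hx<kx)
    ... | η , 0<η , η+η≈kx-hx with h-cont x x∈ η 0<η | k-cont x x∈ η 0<η
    ...   | δ₁ , 0<δ₁ , near₁ | δ₂ , 0<δ₂ , near₂ = separate (total δ₁ δ₂)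
      where
      apart : ∀ y → Within ℝ η (h y) (h x) → Within ℝ η (k y) (k x) → h y < k y
      apart y hy≈hx ky≈kx = +-cancelʳ-< η (begin-strict
        h y + η           <⟨ +-monoˡ-< η (proj₁ (within⇒< hy≈hx)) ⟩
        h x + η + η       ≈⟨ +-assoc (h x) η η ⟩
        h x + (η + η)     ≈⟨ +-congˡ η+η≈kx-hx ⟩
        h x + (k x - h x) ≈⟨ x+[y-x]≈y (h x) (k x) ⟩
        k x               <⟨ proj₂ (within⇒< ky≈kx) ⟩
        k y + η           ∎)

      separate : δ₁ ≤ δ₂ ⊎ δ₂ ≤ δ₁ →
        ∃[ δ ] 0# < δ × (∀ y → _∈[_,_] ℝ y s t → Within ℝ δ y x → h y < k y)
      separate (inj₁ δ₁≤δ₂) = δ₁ , 0<δ₁ , λ y y∈ close →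
        apart y (near₁ y y∈ close) (near₂ y y∈ (within-weaken δ₁≤δ₂ close))
      separate (inj₂ δ₂≤δ₁) = δ₂ , 0<δ₂ , λ y y∈ close →
        apart y (near₁ y y∈ (within-weaken δ₂≤δ₁ close)) (near₂ y y∈ close)

  module _ {s t h k} (h-cont : ContinuousFunction s t h) (k-cont : ContinuousFunction s t k)
           (s≤t : s ≤ t) (hs≤ks : h s ≤ k s) (kt≤ht : k t ≤ h t) where

    private
      -- The functions cross at the supremum of this set: a strict inequality there would, by
      -- `<-open`, persist nearby and contradict the choice of the supremum.
      Below : Carrier → Set
      Below x = _∈[_,_] ℝ x s t × h x ≤ k x

      sup : ∃[ x ] UpperBound Below x × (∀ b → UpperBound Below b → x ≤ b)
      sup = supremum Below (s , (≤-refl , s≤t) , hs≤ks) (t , λ x x∈P → proj₂ (proj₁ x∈P))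

      x₀ : Carrier
      x₀ = proj₁ sup

      upper : UpperBound Below x₀
      upper = proj₁ (proj₂ sup)

      x₀∈ : _∈[_,_] ℝ x₀ s t
      x₀∈ = upper s ((≤-refl , s≤t) , hs≤ks) , proj₂ (proj₂ sup) t (λ y y∈P → proj₂ (proj₁ y∈P))

      -- If the neighbourhood of `x₀` reaches `t`, the inequality persists at `t`, against `kt≤ht`.
      -- Otherwise the point half of δ beyond `x₀` still lies in the interval and in `Below`.
      x₀-not-below : ¬ h x₀ < k x₀
      x₀-not-below hx₀<kx₀ with <-open h-cont k-cont x₀ x₀∈ hx₀<kx₀
      ... | δ , 0<δ , near with t <? x₀ + δ | half δ 0<δ
      ...   | yes t<x₀+δ | _ = <⇒≱ (near t (s≤t , ≤-refl) t-near) kt≤ht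
        where
        t-near : Within ℝ δ t x₀
        t-near = <⇒within t<x₀+δ
          (begin-strict x₀ ≤⟨ proj₂ x₀∈ ⟩ t <⟨ 0<y⇒x<x+y t 0<δ ⟩ t + δ ∎)
      ...   | no t≮x₀+δ | e , 0<e , e+e≈δ = <⇒≱ x₀<y (upper y (y∈ , inj₁ (near y y∈ y-near)))
        where
        y : Carrier
        y = x₀ + e

        x₀<y : x₀ < y
        x₀<y = 0<y⇒x<x+y x₀ 0<e

        y<x₀+δ : y < x₀ + δ
        y<x₀+δ = +-monoʳ-< x₀ (<-respʳ-≈ e+e≈δ (0<y⇒x<x+y e 0<e))

        y∈ : _∈[_,_] ℝ y s t
        y∈ = ≤-trans (proj₁ x₀∈) (inj₁ x₀<y) , ≤-trans (inj₁ y<x₀+δ) (≮⇒≥ t≮x₀+δ)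

        y-near : Within ℝ δ y x₀
        y-near = <⇒within y<x₀+δ (<-trans x₀<y (0<y⇒x<x+y y 0<δ))

      -- No point within δ to the left of `x₀` could be in `Below`, so `x₀ - δ` would be a smaller
      -- upper bound.
      x₀-not-above : ¬ k x₀ < h x₀
      x₀-not-above kx₀<hx₀ with <-open k-cont h-cont x₀ x₀∈ kx₀<hx₀
      ... | δ , 0<δ , near =
        <⇒≱ (x<y+z⇒x-z<y (0<y⇒x<x+y x₀ 0<δ)) (proj₂ (proj₂ sup) (x₀ - δ) smaller)
        where
        smaller : UpperBound Below (x₀ - δ)
        smaller y (y∈ , hy≤ky) = ≮⇒≥ λ x₀-δ<y → <⇒≱ (near y y∈ (<⇒within
          (begin-strict y ≤⟨ upper y (y∈ , hy≤ky) ⟩ x₀ <⟨ 0<y⇒x<x+y x₀ 0<δ ⟩ x₀ + δ ∎)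
          (x-z<y⇒x<y+z x₀-δ<y))) hy≤ky

    abstract
      crossing : ∃[ x ] _∈[_,_] ℝ x s t × h x ≈ k x
      crossing = x₀ , x₀∈ , antisym (≮⇒≥ x₀-not-above) (≮⇒≥ x₀-not-below)

  -- Two points moving in opposite directions on a segment.

  affine : ∀ {r s} a b → s + r ≈ 1# → s * a + r * b ≈ a + r * (b - a)
  affine {r} {s} a b s+r≈1 = begin-equality
    s * a + r * b                   ≈⟨ +-congˡ (*-congˡ (x+[y-x]≈y a b)) ⟨
    s * a + r * (a + (b - a))       ≈⟨ +-congˡ (distribˡ r a (b - a)) ⟩
    s * a + (r * a + r * (b - a))   ≈⟨ +-assoc _ _ _ ⟨
    s * a + r * a + r * (b - a)     ≈⟨ +-congʳ (distribʳ a s r) ⟨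
    (s + r) * a + r * (b - a)       ≈⟨ +-congʳ (*-congʳ s+r≈1) ⟩
    1# * a + r * (b - a)            ≈⟨ +-congʳ (*-identityˡ a) ⟩
    a + r * (b - a)                 ∎

  -- Membership in a segment with the parameter occurring once, so that a single coordinate can
  -- determine it.
  Parametrised : Point ℝ → Point ℝ → Point ℝ → Set
  Parametrised a b p = ∃[ r ] 0# ≤ r × r ≤ 1# × (∀ c → p c ≈ a c + r * (b c - a c))

  parametrise : ∀ {a b p} → OnSegment ℝ a b p → Parametrised a b p
  parametrise {a} {b} (r , 0≤r , r≤1 , on) =
    r , 0≤r , r≤1 , λ c → trans (on c) (affine (a c) (b c) (x-y+y≈x r 1#))

  -- Seen from the other end the parameter is `1# - r`; `affine` applies with the two weights
  -- exchanged.
  parametrise-reverse : ∀ {a b p} → OnSegment ℝ b a p → Parametrised a b p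
  parametrise-reverse {a} {b} (r , 0≤r , r≤1 , on) = 1# - r , 0≤1-r , 1-r≤1 , λ c →
    trans (on c) (trans (+-comm _ _) (affine (a c) (b c) (x+[y-x]≈y r 1#)))
    where
    0≤1-r : 0# ≤ 1# - r
    0≤1-r = begin
      0#       ≈⟨ -‿inverseˡ r ⟨
      - r + r  ≤⟨ +-monoʳ-≤ (- r) r≤1 ⟩
      - r + 1# ≈⟨ +-comm (- r) 1# ⟩
      1# - r   ∎

    1-r≤1 : 1# - r ≤ 1#
    1-r≤1 = begin
      1# - r            ≈⟨ +-identityʳ _ ⟨
      1# - r + 0#       ≤⟨ +-monoʳ-≤ (1# - r) 0≤r ⟩
      1# - r + r        ≈⟨ x-y+y≈x r 1# ⟩
      1#                ∎

  module _ {a b : Point ℝ} {c} (ac<bc : a c < b c) where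

    private
      0<bc-ac : 0# < b c - a c
      0<bc-ac = x<y⇒0<y-x ac<bc

    parametrised-≥ : ∀ {p} → Parametrised a b p → a c ≤ p c
    parametrised-≥ {p} (r , 0≤r , _ , on) = begin
      a c                     ≈⟨ +-identityʳ (a c) ⟨
      a c + 0#                ≈⟨ +-congˡ (zeroˡ _) ⟨
      a c + 0# * (b c - a c)  ≤⟨ +-monoʳ-≤ (a c) (*-monoˡ-≤ 0<bc-ac 0≤r) ⟩
      a c + r * (b c - a c)   ≈⟨ on c ⟨
      p c                     ∎

    parametrised-≤ : ∀ {p} → Parametrised a b p → p c ≤ b c
    parametrised-≤ {p} (r , _ , r≤1 , on) = begin
      p c                     ≈⟨ on c ⟩
      a c + r * (b c - a c)   ≤⟨ +-monoʳ-≤ (a c) (*-monoˡ-≤ 0<bc-ac r≤1) ⟩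
      a c + 1# * (b c - a c)  ≈⟨ +-congˡ (*-identityˡ _) ⟩
      a c + (b c - a c)       ≈⟨ x+[y-x]≈y (a c) (b c) ⟩
      b c                     ∎

    -- Coordinate `c` determines the parameter, as `b c - a c` is positive, and the parameter
    -- determines the point.
    parametrised-injective : ∀ {p q} → Parametrised a b p → Parametrised a b q →
                             p c ≈ q c → _≐_ ℝ p q
    parametrised-injective {p} {q} (r , _ , _ , onp) (s , _ , _ , onq) pc≈qc d = begin-equality
      p d                     ≈⟨ onp d ⟩
      a d + r * (b d - a d)   ≈⟨ +-congˡ (*-congʳ r≈s) ⟩
      a d + s * (b d - a d)   ≈⟨ onq d ⟨
      q d                     ∎
      where
      r≈s : r ≈ s
      r≈s = *-cancelʳ-≈ 0<bc-ac (+-cancelˡ (a c) _ _ (begin-equality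
        a c + r * (b c - a c)   ≈⟨ onp c ⟨
        p c                     ≈⟨ pc≈qc ⟩
        q c                     ≈⟨ onq c ⟩
        a c + s * (b c - a c)   ∎))

    -- Coordinate `c` is least at `a` and greatest at `b` on the segment. One agent at the right
    -- endpoint therefore already orders the two coordinates, in one way at `s` and in the other at
    -- `t`; they cross in between.
    ordered-passing : ∀ {s t} {f g : Carrier → Point ℝ} → s ≤ t →
      ContinuousOn ℝ s t f → ContinuousOn ℝ s t g →
      (∀ x → _∈[_,_] ℝ x s t → Parametrised a b (f x)) →
      (∀ x → _∈[_,_] ℝ x s t → Parametrised a b (g x)) →
      _≐_ ℝ (f s) a ⊎ _≐_ ℝ (g s) b → _≐_ ℝ (f t) b ⊎ _≐_ ℝ (g t) a →
      ∃[ x ] _∈[_,_] ℝ x s t × _≐_ ℝ (f x) (g x)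
    ordered-passing {s} {t} {f} {g} s≤t f-cont g-cont f-on g-on start end
      = x , x∈ , parametrised-injective (f-on x x∈) (g-on x x∈) (proj₂ (proj₂ crossed))
      where
      s∈ : _∈[_,_] ℝ s s t
      s∈ = ≤-refl , s≤t

      t∈ : _∈[_,_] ℝ t s t
      t∈ = s≤t , ≤-refl

      starts : _≐_ ℝ (f s) a ⊎ _≐_ ℝ (g s) b → f s c ≤ g s c
      starts (inj₁ fs≐a) = ≤-trans (inj₂ (fs≐a c)) (parametrised-≥ (g-on s s∈))
      starts (inj₂ gs≐b) = ≤-trans (parametrised-≤ (f-on s s∈)) (inj₂ (sym (gs≐b c)))

      ends : _≐_ ℝ (f t) b ⊎ _≐_ ℝ (g t) a → g t c ≤ f t c
      ends (inj₁ ft≐b) = ≤-trans (parametrised-≤ (g-on t t∈)) (inj₂ (sym (ft≐b c)))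
      ends (inj₂ gt≐a) = ≤-trans (inj₂ (gt≐a c)) (parametrised-≥ (f-on t t∈))

      crossed : ∃[ x ] _∈[_,_] ℝ x s t × f x c ≈ g x c
      crossed = crossing (coordinate-continuous f-cont c) (coordinate-continuous g-cont c)
                  s≤t (starts start) (ends end)

      x : Carrier
      x = proj₁ crossed

      x∈ : _∈[_,_] ℝ x s t
      x∈ = proj₁ (proj₂ crossed)

  passing : ∀ {a b s t} {f g : Carrier → Point ℝ} → ¬ _≐_ ℝ a b → s ≤ t →
    ContinuousOn ℝ s t f → ContinuousOn ℝ s t g →
    (∀ x → _∈[_,_] ℝ x s t → OnSegment ℝ a b (f x)) →
    (∀ x → _∈[_,_] ℝ x s t → OnSegment ℝ b a (g x)) →
    _≐_ ℝ (f s) a ⊎ _≐_ ℝ (g s) b → _≐_ ℝ (f t) b ⊎ _≐_ ℝ (g t) a →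
    ∃[ x ] _∈[_,_] ℝ x s t × _≐_ ℝ (f x) (g x)
  passing {a} {b} {s} {t} {f} {g} a≭b s≤t f-cont g-cont f-on g-on start end
    = oriented (compare (a c) (b c))
    where
    different : ∃[ c ] ¬ a c ≈ b c
    different = ¬∀⟶∃¬ 3 (λ c → a c ≈ b c) (λ c → a c ≟ b c) a≭b

    c = proj₁ different

    exchange : ∃[ x ] _∈[_,_] ℝ x s t × _≐_ ℝ (g x) (f x) →
               ∃[ x ] _∈[_,_] ℝ x s t × _≐_ ℝ (f x) (g x)
    exchange (x , x∈ , eq) = x , x∈ , λ d → sym (eq d)

    oriented : Tri (a c < b c) (a c ≈ b c) (b c < a c) →
               ∃[ x ] _∈[_,_] ℝ x s t × _≐_ ℝ (f x) (g x)
    oriented (tri≈ _ ac≈bc _) = contradiction ac≈bc (proj₂ different)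
    oriented (tri< ac<bc _ _) = ordered-passing {a} {b} {c} ac<bc {f = f} {g} s≤t f-cont g-cont
      (λ x x∈ → parametrise (f-on x x∈)) (λ x x∈ → parametrise-reverse (g-on x x∈)) start end
    -- When the coordinate decreases from `a` to `b`, the two agents exchange roles.
    oriented (tri> _ _ bc<ac) = exchange (ordered-passing {b} {a} {c} bc<ac {f = g} {f} s≤t
      g-cont f-cont
      (λ x x∈ → parametrise (g-on x x∈)) (λ x x∈ → parametrise-reverse (f-on x x∈))
      (Sum.swap start) (Sum.swap end))

  -- Meeting of two walks.

  module _ {G : PortGraph} {E : Embedding ℝ G} where
    open PortGraph G
    open Embedding E

    module _ {a b : ℕ → Node} (f : Walk ℝ G E a) (g : Walk ℝ G E b) where
      private
        module f = Walk f
        module g = Walk g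

      -- f on its edge m and g on its edge k at a common time.
      Overlap : ℕ → ℕ → Set
      Overlap m k = f.time m ≤ g.time (suc k) × g.time k ≤ f.time (suc m)

      -- When one agent leaves its edge first, the other is still on its own edge at that moment, so
      -- the overlap passes to the next edge of the former. Each advance raises `m + k` by one.
      overlap-diagonal : ∀ r m k → Overlap m k →
        ∃[ m′ ] ∃[ k′ ] m′ ℕ.+ k′ ≡ r ℕ.+ (m ℕ.+ k) × Overlap m′ k′
      overlap-diagonal zero m k o = m , k , ≡.refl , o
      overlap-diagonal (suc r) m k o with total (f.time (suc m)) (g.time (suc k))
      ... | inj₁ f≤g with overlap-diagonal r (suc m) k
                            (f≤g , ≤-trans (proj₂ o) (inj₁ (f.increasing (suc m))))
      ...   | m′ , k′ , eq , o′ = m′ , k′ , ≡.trans eq (ℕ.+-suc r (m ℕ.+ k)) , o′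
      overlap-diagonal (suc r) m k o | inj₂ g≤f with overlap-diagonal r m (suc k)
                            (≤-trans (proj₁ o) (inj₁ (g.increasing (suc k))) , g≤f)
      ...   | m′ , k′ , eq , o′ = m′ , k′ ,
        ≡.trans eq (≡.trans (≡.cong (r ℕ.+_) (ℕ.+-suc m k)) (ℕ.+-suc r (m ℕ.+ k))) , o′

      -- The common interval runs from the later departure to the earlier arrival, and the four
      -- cases say which agent each of these belongs to. It is nonempty by the overlap if they
      -- belong to different agents, by increasing times otherwise.
      meet-on-edge : ∀ m k → a m ≢ a (suc m) → (b (suc k) , b k) ≡ (a m , a (suc m)) →
                     Overlap m k → Meet ℝ G f g
      meet-on-edge m k am≢am+1 eq (f≤g , g≤f) =
        meeting (total (f.time m) (g.time k)) (total (f.time (suc m)) (g.time (suc k)))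
        where
        f≤f = inj₁ (f.increasing m)
        g≤g = inj₁ (g.increasing k)

        bk+1≡am : b (suc k) ≡ a m
        bk+1≡am = ≡.cong proj₁ eq

        bk≡am+1 : b k ≡ a (suc m)
        bk≡am+1 = ≡.cong proj₂ eq

        meet-within : ∀ {s t} → f.time m ≤ s → g.time k ≤ s → t ≤ f.time (suc m) →
          t ≤ g.time (suc k) → s ≤ t →
          _≐_ ℝ (f.piece m s) (point (a m)) ⊎ _≐_ ℝ (g.piece k s) (point (b k)) →
          _≐_ ℝ (f.piece m t) (point (a (suc m))) ⊎ _≐_ ℝ (g.piece k t) (point (b (suc k))) →
          Meet ℝ G f g
        meet-within fm≤s gk≤s t≤fm+1 t≤gk+1 s≤t start end
          with passing (am≢am+1 ∘ point-injective) s≤t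
                 (continuous-⊆ fm≤s t≤fm+1 (f.continuous m))
                 (continuous-⊆ gk≤s t≤gk+1 (g.continuous k))
                 (λ x x∈ → f.onEdge m x (∈-⊆ fm≤s t≤fm+1 x∈))
                 (λ x x∈ → ≡.subst₂ (λ u v → OnSegment ℝ (point u) (point v) (g.piece k x))
                             bk≡am+1 bk+1≡am (g.onEdge k x (∈-⊆ gk≤s t≤gk+1 x∈)))
                 (Sum.map₂ (≡.subst (λ u → _≐_ ℝ _ (point u)) bk≡am+1) start)
                 (Sum.map₂ (≡.subst (λ u → _≐_ ℝ _ (point u)) bk+1≡am) end)
        ... | x , x∈ , fx≐gx = x , g.piece k x ,
          (m , ∈-⊆ fm≤s t≤fm+1 x∈ , fx≐gx) , (k , ∈-⊆ gk≤s t≤gk+1 x∈ , λ _ → refl)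

        meeting : f.time m ≤ g.time k ⊎ g.time k ≤ f.time m →
                  f.time (suc m) ≤ g.time (suc k) ⊎ g.time (suc k) ≤ f.time (suc m) →
                  Meet ℝ G f g
        meeting (inj₁ fm≤gk) (inj₁ fm+1≤gk+1) =
          meet-within fm≤gk ≤-refl ≤-refl fm+1≤gk+1 g≤f (inj₂ (g.departs k)) (inj₁ (f.arrives m))
        meeting (inj₁ fm≤gk) (inj₂ gk+1≤fm+1) =
          meet-within fm≤gk ≤-refl gk+1≤fm+1 ≤-refl g≤g (inj₂ (g.departs k)) (inj₂ (g.arrives k))
        meeting (inj₂ gk≤fm) (inj₁ fm+1≤gk+1) =
          meet-within ≤-refl gk≤fm ≤-refl fm+1≤gk+1 f≤f (inj₁ (f.departs m)) (inj₁ (f.arrives m))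
        meeting (inj₂ gk≤fm) (inj₂ gk+1≤fm+1) =
          meet-within ≤-refl gk≤fm gk+1≤fm+1 ≤-refl f≤g (inj₁ (f.departs m)) (inj₂ (g.arrives k))

      overlap-initial : Overlap 0 0
      overlap-initial =
        ≤-trans (inj₂ (trans f.time-zero (sym g.time-zero))) (inj₁ (g.increasing 0)) ,
        ≤-trans (inj₂ (trans g.time-zero (sym f.time-zero))) (inj₁ (f.increasing 0))

      -- After `n` advances from the initial pair of edges, `m + k` equals `n`, which is the
      -- condition for edges `m` and `k` to be opposite.
      opposite-walks-meet : ∀ n → (∀ m → a m ≢ a (suc m)) →
        (∀ m k → suc (m ℕ.+ k) ≡ suc n → (b (suc k) , b k) ≡ (a m , a (suc m))) →
        Meet ℝ G f g
      opposite-walks-meet n moves opposite with overlap-diagonal n 0 0 overlap-initial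
      ... | m , k , eq , o = meet-on-edge m k (moves m)
        (opposite m k (≡.cong suc (≡.trans eq (ℕ.+-identityʳ n)))) o

theorem3p1 : (em : ExcludedMiddle 0ℓ) (ℝ : CompleteOrderedField)
    (φ : ℕ⁺ ⤖ Quadruple)
    (G : PortGraph) → PortGraph.Node G ↣ ℕ → PortGraph.Connected G →
    (E : Embedding ℝ G)
    (i j : ℕ⁺) → i ≢ j →
    (v w : PortGraph.Node G) → v ≢ w →
    (ρ : Route em G φ v i) (σ : Route em G φ w j)
    (f : Walk ℝ G E (Route.node ρ)) (g : Walk ℝ G E (Route.node σ)) →
    Meet ℝ G f g
theorem3p1 em ℝ φ G _ connected E i j i≢j v w v≢w ρ σ f g =
  opposite-walks-meet ℝ f g (proj₁ opposite)
    -- Consecutive nodes of a route differ because the graph has no loops.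
    (λ m am≡am+1 → PortGraph.irreflexive G am≡am+1 (Route.adjacent ρ m)) (proj₂ opposite)
  where opposite = opposite-routes G em φ i≢j (connected v w) v≢w ρ σ
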